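{- Let $k$ be a positive integer and $\alpha_1,\dots,\alpha_k$ positive real numbers. Then there is an integer $m$ and a subset $A\subset\mathbb R$ with $|A|=m+1$ such that for every positive integer $n$, every subset $B\subset A^n\subset\mathbb R^n_\infty$ with $|B|>m^n$ contains a copy of $\mathcal B(\alpha_1,\dots,\alpha_k)$.
   Context: $\mathbb{R}^n_\infty$ denotes $\mathbb{R}^n$ with the maximum metric $\|\mathbf x-\mathbf y\|_\infty=\max_i|x_i-y_i|$. The baton $\mathcal B(\alpha_1,\dots,\alpha_k)$ is the metric space $\{0,\alpha_1,\alpha_1+\alpha_2,\dots,\sum_{i=1}^k\alpha_i\}\subset\mathbb R$ with the metric induced from $\mathbb R$. A copy of it in $\mathbb R^n_\infty$ is a subset isometric to it. -}

module Defs where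

open import Data.Nat using (ℕ; zero; suc)
import Data.Fin
open import Data.Fin using (Fin; zero; suc)
open import Data.Vec using (Vec; lookup)
open import Data.List using (List)
open import Data.List.Membership.Propositional using (_∈_)
open import Data.Product using (Σ; ∃; _×_; _,_)
open import Data.Sum using (_⊎_)
open import Relation.Nullary using (¬_)
open import Relation.Binary.PropositionalEquality using (_≡_)
open import Relation.Binary.Definitions using (Trichotomous)

-- The real numbers, axiomatised as a complete ordered field
-- (unique up to isomorphism, so quantifying over all of them is faithful).
record RealField : Set₁ where
  infixl 6 _+_ _-_
  infixl 7 _*_
  infix 4 _<_ _≤_
  field
    ℝ    : Set
    0ℝ 1ℝ : ℝ
    _+_ _*_ : ℝ → ℝ → ℝ
    -_   : ℝ → ℝ
    _⁻¹  : ℝ → ℝ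
    _<_  : ℝ → ℝ → Set
    +-assoc : ∀ x y z → (x + y) + z ≡ x + (y + z)
    +-comm  : ∀ x y → x + y ≡ y + x
    +-identityʳ : ∀ x → x + 0ℝ ≡ x
    +-inverseʳ  : ∀ x → x + (- x) ≡ 0ℝ
    *-assoc : ∀ x y z → (x * y) * z ≡ x * (y * z)
    *-comm  : ∀ x y → x * y ≡ y * x
    *-identityʳ : ∀ x → x * 1ℝ ≡ x
    *-inverseʳ  : ∀ x → ¬ (x ≡ 0ℝ) → x * (x ⁻¹) ≡ 1ℝ
    distribˡ : ∀ x y z → x * (y + z) ≡ x * y + x * z
    0≢1 : ¬ (0ℝ ≡ 1ℝ)
    <-irrefl : ∀ x → ¬ (x < x)
    <-trans  : ∀ {x y z} → x < y → y < z → x < z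
    <-tri    : Trichotomous _≡_ _<_
    +-mono-< : ∀ {x y} z → x < y → x + z < y + z
    *-pos    : ∀ {x y} → 0ℝ < x → 0ℝ < y → 0ℝ < x * y

  _-_ : ℝ → ℝ → ℝ
  x - y = x + (- y)

  _≤_ : ℝ → ℝ → Set
  x ≤ y = x < y ⊎ x ≡ y

  field
    sup : (S : ℝ → Set) → Σ ℝ S → Σ ℝ (λ b → ∀ x → S x → x ≤ b) →
          Σ ℝ (λ s → (∀ x → S x → x ≤ s) × (∀ b → (∀ x → S x → x ≤ b) → s ≤ b))

module _ (R : RealField) where
  open RealField R

  -- |x| ≡ c, for c ≥ 0
  AbsEq : ℝ → ℝ → Set
  AbsEq x c = x ≡ c ⊎ (- x) ≡ c

  AbsLe : ℝ → ℝ → Set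
  AbsLe x c = ((- c) ≤ x) × (x ≤ c)

  -- ‖x − y‖∞ = c in ℝⁿ_∞ (for c ≥ 0): every coordinate gap ≤ c, and one attains c
  -- (when c = 0 and n = 0 the empty max is 0).
  DistEq : (n : ℕ) → (Fin n → ℝ) → (Fin n → ℝ) → ℝ → Set
  DistEq n x y c = (∀ i → AbsLe (x i - y i) c) × ((c ≡ 0ℝ) ⊎ (∃ λ i → AbsEq (x i - y i) c))

  -- points of the baton B(α₁,…,α_k): p j = α₁ + … + α_j, for j = 0,…,k
  partialSum : (k : ℕ) → (Fin k → ℝ) → Fin (suc k) → ℝ
  partialSum k α zero = 0ℝ
  partialSum (suc k) α (suc j) = α zero + partialSum k (λ i → α (suc i)) j

  IsBatonCopy : (k : ℕ) → (Fin k → ℝ) → (n : ℕ) → (Fin (suc k) → (Fin n → ℝ)) → Set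
  IsBatonCopy k α n f =
    ∀ i j → i Data.Fin.≤ j → DistEq n (f i) (f j) (partialSum k α j - partialSum k α i)

  -- the point of Aⁿ with coordinate indices v, where A = {a 0, …, a m}
  point : {m n : ℕ} → (Fin (suc m) → ℝ) → Vec (Fin (suc m)) n → (Fin n → ℝ)
  point a v i = a (lookup v i)

{-# OPTIONS --safe #-}
module Submission where

-- If the steps are comparable, let A be a path a₀ < … < aᵣ through the baton whose gaps are at most
-- the least step.  If some fibre of B over the remaining coordinates is all of A, it is a copy.
-- Otherwise a fibre F ≠ A meets at least |F| of the r edges {aⱼ , aⱼ₊₁}, so the projection to the
-- remaining coordinates of the part of B lying over some edge has more than rⁿ⁻¹ points; a copy there
-- lifts, since the new coordinate moves by at most one gap.
--
-- RealField yields the Archimedean property only up to double negation, so the number of gaps must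
-- not depend on ratios of steps.  Hence A = T + U in levels: T is a path as above, and U, built from
-- the smaller steps, has a diameter less than every gap of T.  A row t ∈ Tⁿ of B has a set
-- G(t) of coordinates along which it contains a copy of the small baton, and at most
-- (q+1)^|G(t)| q^(n-|G(t)|) points where |U| = q + 1; the path argument for T is then run on the
-- function G.  The bound for A is again |A| - 1 because q(r+1) + r = (q+1)(r+1) - 1.

open import Defs
open import Data.Bool using (Bool; true; false; _∨_)
import Data.Bool.Properties as Bool
open import Data.Nat using (ℕ; zero; suc; _^_) renaming (_<_ to _<ℕ_)
open import Data.Fin using (Fin; zero; suc; inject₁; combine; remQuot; _↑ˡ_; _↑ʳ_)
import Data.Fin as Fin
import Data.Fin.Properties as Fin
open import Data.Vec using (Vec; []; _∷_; lookup; head; tail; zipWith; replicate; allFin)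
open import Data.Vec.Membership.Propositional using () renaming (_∈_ to _∈ᵛ_)
open import Data.Vec.Membership.Propositional.Properties using (∈-allFin⁺)
open import Data.Vec.Properties using (lookup-zipWith; lookup-replicate; ≡-dec)
open import Data.Vec.Relation.Unary.All using (All; []; _∷_)
open import Data.Vec.Relation.Unary.Any using (here; there)
open import Data.List using (List; []; _∷_; length)
import Data.List.Relation.Unary.All as List
open import Data.List.Relation.Unary.AllPairs using ([]; _∷_)
open import Data.List.Relation.Unary.Unique.Propositional using (Unique)
open import Data.List.Membership.Propositional using (_∈_)
import Data.List.Membership.DecPropositional as DecMembership
open import Data.Product using (Σ; ∃; _×_; _,_; proj₁; proj₂)
open import Data.Sum using (_⊎_; inj₁; inj₂; [_,_]′)
open import Algebra.Bundles using (CommutativeRing)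
open import Algebra.Structures using (IsCommutativeRing)
import Algebra.Properties.Ring
import Algebra.Properties.Semiring.Sum
import Algebra.Solver.CommutativeMonoid
open import Function using (_∘_)
open import Function.Definitions using (Injective)
open import Relation.Binary.Definitions using (tri<; tri≈; tri>)
import Relation.Binary.Construct.StrictToNonStrict
open import Relation.Binary.PropositionalEquality
  using (_≡_; _≢_; refl; sym; trans; cong; cong₂; subst; subst₂; isEquivalence; resp₂; module ≡-Reasoning)
open import Relation.Nullary using (¬_; yes; no; does; contradiction)
open import Relation.Nullary.Decidable using (dec-true)

module Combinatorics where

  open import Data.Nat using (_+_; _*_; _⊔_; _≤_; _<_; z≤n; s≤s)
  open import Data.Nat.Properties
  open import Data.Nat.Tactic.RingSolver using (solve-∀)
  open Algebra.Properties.Semiring.Sum +-*-semiring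
    using (sum; sum-cong-≗; ∑-comm; ∑-distrib-+; *-distribˡ-sum)

  -- Finite sums and comparisons between them.

  sum-mono : ∀ {n} {f g : Fin n → ℕ} → (∀ i → f i ≤ g i) → sum f ≤ sum g
  sum-mono {zero}  f≤g = z≤n
  sum-mono {suc n} f≤g = +-mono-≤ (f≤g zero) (sum-mono (f≤g ∘ suc))

  sum≤* : ∀ {n} {f : Fin n → ℕ} {b} → (∀ i → f i ≤ b) → sum f ≤ n * b
  sum≤* {zero}  f≤b = z≤n
  sum≤* {suc n} f≤b = +-mono-≤ (f≤b zero) (sum≤* (f≤b ∘ suc))

  sum-compare : ∀ {n} (f g : Fin n → ℕ) → sum f ≤ sum g ⊎ ∃ λ i → g i < f i
  sum-compare {zero}  f g = inj₁ z≤n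
  sum-compare {suc n} f g with f zero ≤? g zero | sum-compare (f ∘ suc) (g ∘ suc)
  ... | yes f≤g | inj₁ le        = inj₁ (+-mono-≤ f≤g le)
  ... | no  f≰g | _              = inj₂ (zero , ≰⇒> f≰g)
  ... | _       | inj₂ (i , g<f) = inj₂ (suc i , g<f)

  sum-combine : ∀ r q (f : Fin (r * q) → ℕ) → sum f ≡ sum {r} (λ x → sum {q} (λ y → f (combine x y)))
  sum-combine zero    q f = refl
  sum-combine (suc r) q f = trans (sum-split q f) (cong (sum (λ y → f (y ↑ˡ (r * q))) +_) (sum-combine r q (f ∘ (q ↑ʳ_))))
    where
    sum-split : ∀ m {n} (f : Fin (m + n) → ℕ) → sum f ≡ sum (λ i → f (i ↑ˡ n)) + sum (λ i → f (m ↑ʳ i))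
    sum-split zero    f = refl
    sum-split (suc m) f = trans (cong (f zero +_) (sum-split m (f ∘ suc))) (sym (+-assoc (f zero) _ _))

  -- Left of x the nodes are charged to the edges on their right, beyond x to those on their left.
  sum≤sum-edges : ∀ {r} (f : Fin (suc r) → ℕ) x → f x ≡ 0 → sum f ≤ sum (λ j → f (inject₁ j) ⊔ f (suc j))
  sum≤sum-edges {zero}  f zero fx≡0 = ≤-reflexive (trans (+-identityʳ _) fx≡0)
  sum≤sum-edges {suc r} f zero fx≡0 =
    subst (λ z → z + sum (f ∘ suc) ≤ sum (λ j → f (inject₁ j) ⊔ f (suc j))) (sym fx≡0)
      (sum-mono {f = f ∘ suc} (λ j → m≤n⊔m (f (inject₁ j)) (f (suc j))))
  sum≤sum-edges {suc r} f (suc x) fx≡0 =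
    +-mono-≤ (m≤m⊔n (f zero) (f (suc zero))) (sum≤sum-edges (f ∘ suc) x fx≡0)

  -- Sums over all words of length `n`.

  vsum : ∀ {k} n → (Vec (Fin k) n → ℕ) → ℕ
  vsum zero    f = f []
  vsum (suc n) f = sum (λ c → vsum n (f ∘ (c ∷_)))

  vsum-mono : ∀ {k} n {f g : Vec (Fin k) n → ℕ} → (∀ v → f v ≤ g v) → vsum n f ≤ vsum n g
  vsum-mono zero    f≤g = f≤g []
  vsum-mono (suc n) f≤g = sum-mono (λ c → vsum-mono n (f≤g ∘ (c ∷_)))

  vsum-+ : ∀ {k} n (f g : Vec (Fin k) n → ℕ) → vsum n (λ v → f v + g v) ≡ vsum n f + vsum n g
  vsum-+ zero    f g = refl
  vsum-+ (suc n) f g = trans (sum-cong-≗ (λ c → vsum-+ n (f ∘ (c ∷_)) (g ∘ (c ∷_)))) (∑-distrib-+ (λ c → vsum n (f ∘ (c ∷_))) (λ c → vsum n (g ∘ (c ∷_))))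

  vsum-* : ∀ {k} n c (f : Vec (Fin k) n → ℕ) → vsum n (λ v → c * f v) ≡ c * vsum n f
  vsum-* zero    c f = refl
  vsum-* (suc n) c f = trans (sum-cong-≗ (λ d → vsum-* n c (f ∘ (d ∷_)))) (sym (*-distribˡ-sum c (λ d → vsum n (f ∘ (d ∷_)))))

  vsum-sum : ∀ {k} n {l} (f : Fin l → Vec (Fin k) n → ℕ) →
             vsum n (λ v → sum (λ i → f i v)) ≡ sum (λ i → vsum n (f i))
  vsum-sum zero    f = refl
  vsum-sum (suc n) f = trans (sum-cong-≗ (λ c → vsum-sum n (λ i → f i ∘ (c ∷_)))) (∑-comm (λ c i → vsum n (f i ∘ (c ∷_))))

  -- Provides the case split in `sweeps`: either an averaged estimate holds, or a particular fibre
  -- that violates it is exhibited.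
  vsum-compare : ∀ {k} n (f g : Vec (Fin k) n → ℕ) → vsum n f ≤ vsum n g ⊎ ∃ λ v → g v < f v
  vsum-compare zero f g with f [] ≤? g []
  ... | yes f≤g = inj₁ f≤g
  ... | no  f≰g = inj₂ ([] , ≰⇒> f≰g)
  vsum-compare (suc n) f g with sum-compare (λ c → vsum n (f ∘ (c ∷_))) (λ c → vsum n (g ∘ (c ∷_)))
  ... | inj₁ le = inj₁ le
  ... | inj₂ (c , lt) with vsum-compare n (f ∘ (c ∷_)) (g ∘ (c ∷_))
  ...   | inj₁ le        = contradiction lt (≤⇒≯ le)
  ...   | inj₂ (v , g<f) = inj₂ (c ∷ v , g<f)

  -- Lets a count over words in pairs be done row by row, with the upper-level word `t` fixed. In
  -- the induction the sum over the lower letter `y` has to move past the words `t`, which is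
  -- `vsum-sum`.
  vsum-combine : ∀ r q n (f : Vec (Fin (r * q)) n → ℕ) →
                 vsum n f ≡ vsum {r} n (λ t → vsum {q} n (λ u → f (zipWith combine t u)))
  vsum-combine r q zero    f = refl
  vsum-combine r q (suc n) f = begin
    sum (λ c → vsum n (f ∘ (c ∷_)))
      ≡⟨ sum-combine r q (λ c → vsum n (f ∘ (c ∷_))) ⟩
    sum (λ x → sum (λ y → vsum n (f ∘ (combine {r} {q} x y ∷_))))
      ≡⟨ sum-cong-≗ {r} (λ x → sum-cong-≗ {q} (λ y → vsum-combine r q n (f ∘ (combine x y ∷_)))) ⟩
    sum (λ x → sum (λ y → vsum n (λ t → row x y t)))
      ≡⟨ sum-cong-≗ (λ x → sym (vsum-sum n (row x))) ⟩
    sum (λ x → vsum n (λ t → sum (λ y → row x y t))) ∎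
    where
    open ≡-Reasoning
    row : Fin r → Fin q → Vec (Fin r) n → ℕ
    row x y t = vsum {q} n (λ u → f (combine x y ∷ zipWith combine t u))

  -- Sets of directions and their weights.

  bit : Bool → ℕ
  bit true  = 1
  bit false = 0

  -- A `Vec Bool n` encodes a set G of coordinates, and this is the number (q+1)^|G| q^(n-|G|), in a
  -- form that splits off one coordinate at a time.
  weight : ∀ {n} → ℕ → Vec Bool n → ℕ
  weight q []      = 1
  weight q (b ∷ G) = (q + bit b) * weight q G

  bit-mono : ∀ b c → bit b ≤ bit (b ∨ c)
  bit-mono true  c = ≤-refl
  bit-mono false c = z≤n

  weight-∨ˡ : ∀ {n} q (G H : Vec Bool n) → weight q G ≤ weight q (zipWith _∨_ G H)
  weight-∨ˡ q []      []      = ≤-refl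
  weight-∨ˡ q (b ∷ G) (c ∷ H) = *-mono-≤ (+-monoʳ-≤ q (bit-mono b c)) (weight-∨ˡ q G H)

  weight-∨ʳ : ∀ {n} q (G H : Vec Bool n) → weight q H ≤ weight q (zipWith _∨_ G H)
  weight-∨ʳ q []      []      = ≤-refl
  weight-∨ʳ q (b ∷ G) (c ∷ H) =
    *-mono-≤ (+-monoʳ-≤ q (subst (λ d → bit c ≤ bit d) (Bool.∨-comm c b) (bit-mono c b))) (weight-∨ʳ q G H)

  weight-false : ∀ {n} q (G : Vec Bool n) → (∀ i → lookup G i ≢ true) → weight q G ≡ q ^ n
  weight-false q []          no-true = refl
  weight-false q (true ∷ G)  no-true = contradiction refl (no-true zero)
  weight-false q (false ∷ G) no-true = cong₂ _*_ (+-identityʳ q) (weight-false q G (no-true ∘ suc))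

  weight-head : ∀ {n} q (G : Vec Bool (suc n)) → weight q G ≡ (q + bit (head G)) * weight q (tail G)
  weight-head q (b ∷ G) = refl

  lookup-tail : ∀ {n} {A : Set} (v : Vec A (suc n)) i → lookup (tail v) i ≡ lookup v (suc i)
  lookup-tail (x ∷ v) i = refl

  -- Sweeps along a path with `r` edges.

  module _ {r : ℕ} where

    OnEdge : Fin r → Fin (suc r) → Set
    OnEdge j x = x ≡ inject₁ j ⊎ x ≡ suc j

    -- This is what the metric side consumes: positions of near nodes differ by at most one gap.
    -- Equality is a separate case because a path with r = 0 has a node but no edge.
    Near : Fin (suc r) → Fin (suc r) → Set
    Near x y = x ≡ y ⊎ ∃ λ j → OnEdge j x × OnEdge j y

    -- A walk along T in direction i through points marked at i; every other coordinate stays on one edge.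
    record Sweep {n} (G : Vec (Fin (suc r)) n → Vec Bool n) (i : Fin n) : Set where
      field
        pt     : Fin (suc r) → Vec (Fin (suc r)) n
        at     : ∀ x → lookup (pt x) i ≡ x
        marked : ∀ x → lookup (G (pt x)) i ≡ true
        near   : ∀ x y l → l ≢ i → Near (lookup (pt x) l) (lookup (pt y) l)

    -- Lifts a sweep from a projection. `C` is the set of values allowed for the restored
    -- coordinate: one node for a slice, the two ends of an edge for a union of two slices. The
    -- value may be chosen anew at each point of the sweep, since any two members of `C` are near.
    sweep-suc : ∀ {n} (G : Vec (Fin (suc r)) (suc n) → Vec Bool (suc n)) (G′ : Vec (Fin (suc r)) n → Vec Bool n)
      (C : Fin (suc r) → Set) → (∀ {x y} → C x → C y → Near x y) →
      (∀ w i → lookup (G′ w) i ≡ true → ∃ λ x → C x × lookup (G (x ∷ w)) (suc i) ≡ true) →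
      ∀ {i} → Sweep G′ i → Sweep G (suc i)
    sweep-suc G G′ C C-near extend {i} S = record
      { pt     = λ x → proj₁ (ext x) ∷ pt x
      ; at     = at
      ; marked = λ x → proj₂ (proj₂ (ext x))
      ; near   = near′
      }
      where
      open Sweep S
      ext = λ x → extend (pt x) i (marked x)
      near′ : ∀ x y l → l ≢ suc i → Near (lookup (proj₁ (ext x) ∷ pt x) l) (lookup (proj₁ (ext y) ∷ pt y) l)
      near′ x y zero    _   = C-near (proj₁ (proj₂ (ext x))) (proj₁ (proj₂ (ext y)))
      near′ x y (suc l) l≢i = near x y l (l≢i ∘ cong suc)

    -- The induction in `sweeps` yields one set of directions per node and per edge; keeping the
    -- heaviest gives a single bound for all of them. The base `x₀` allows for an empty family, as
    -- there may be no edges.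
    largest : ∀ {A : Set} {P : A → Set} (key : A → ℕ) {n} (x₀ : Σ A P) (x : Fin n → Σ A P) →
      Σ (Σ A P) λ y → key (proj₁ x₀) ≤ key (proj₁ y) × (∀ i → key (proj₁ (x i)) ≤ key (proj₁ y))
    largest key {zero}  x₀ x = x₀ , ≤-refl , λ ()
    largest key {suc n} x₀ x with largest key x₀ (x ∘ suc)
    ... | y , x₀≤y , x≤y with ≤-total (key (proj₁ (x zero))) (key (proj₁ y))
    ...   | inj₁ le = y , x₀≤y , λ { zero → le ; (suc i) → x≤y i }
    ...   | inj₂ ge = x zero , ≤-trans x₀≤y ge , λ { zero → ≤-refl ; (suc i) → ≤-trans (x≤y i) ge }

    -- Induction on `n`, splitting off the first coordinate. Each slice at a node and each union of
    -- two adjacent slices has sweeps and a bound; let M be the largest bound. If the estimate by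
    -- `h` holds on average over the fibres, the new coordinate stays unmarked and contributes the
    -- factor m. A fibre on which it fails is itself a sweep in the new direction, and then the
    -- factor m + 1 is allowed.
    sweeps : ∀ q n (G : Vec (Fin (suc r)) n → Vec Bool n) →
      Σ (Vec Bool n) λ H → (∀ i → lookup H i ≡ true → Sweep G i) × vsum n (weight q ∘ G) ≤ weight (q + r * suc q) H
    sweeps q zero    G = [] , (λ ()) , ≤-reflexive (weight-nil (G []))
      where
      weight-nil : (G : Vec Bool 0) → weight q G ≡ 1
      weight-nil [] = refl
    sweeps q (suc n) G = conclude (vsum-compare n f h)
      where
      m = q + r * suc q
      SweepsAt : Vec Bool n → Set
      SweepsAt H = ∀ i → lookup H i ≡ true → Sweep G (suc i)

      node : Fin (suc r) → Vec (Fin (suc r)) n → Vec Bool n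
      node x w = tail (G (x ∷ w))
      -- A direction counts for an edge when it is marked at either end; the lift then picks an end
      -- where it is marked.
      edge : Fin r → Vec (Fin (suc r)) n → Vec Bool n
      edge j w = zipWith _∨_ (node (inject₁ j) w) (node (suc j) w)

      node-suc : ∀ x {i} → Sweep (node x) i → Sweep G (suc i)
      node-suc x = sweep-suc G (node x) (_≡ x) (λ p q → inj₁ (trans p (sym q)))
        (λ w i p → x , refl , trans (sym (lookup-tail (G (x ∷ w)) i)) p)
      edge-suc : ∀ j {i} → Sweep (edge j) i → Sweep G (suc i)
      edge-suc j = sweep-suc G (edge j) (OnEdge j) (λ p q → inj₂ (j , p , q)) ext
        where
        ext : ∀ w i → lookup (edge j w) i ≡ true → ∃ λ x → OnEdge j x × lookup (G (x ∷ w)) (suc i) ≡ true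
        ext w i p with lookup (node (inject₁ j) w) i in eq | lookup-zipWith _∨_ i (node (inject₁ j) w) (node (suc j) w)
        ... | true  | _ = inject₁ j , inj₁ refl , trans (sym (lookup-tail (G (inject₁ j ∷ w)) i)) eq
        ... | false | e = suc j , inj₂ refl , trans (sym (lookup-tail (G (suc j ∷ w)) i)) (trans (sym e) p)

      fromNode : Fin (suc r) → Σ (Vec Bool n) SweepsAt
      fromNode x = let H , sw , _ = sweeps q n (node x) in H , λ i p → node-suc x (sw i p)
      fromEdge : Fin r → Σ (Vec Bool n) SweepsAt
      fromEdge j = let H , sw , _ = sweeps q n (edge j) in H , λ i p → edge-suc j (sw i p)

      bestNode = largest (weight m) (fromNode zero) fromNode
      best     = largest (weight m) (proj₁ bestNode) fromEdge
      H = proj₁ (proj₁ best)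
      M = weight m H

      node≤M : ∀ x → vsum n (weight q ∘ node x) ≤ M
      node≤M x = ≤-trans (proj₂ (proj₂ (sweeps q n (node x)))) (≤-trans (proj₂ (proj₂ bestNode) x) (proj₁ (proj₂ best)))
      edge≤M : ∀ j → vsum n (weight q ∘ edge j) ≤ M
      edge≤M j = ≤-trans (proj₂ (proj₂ (sweeps q n (edge j)))) (proj₂ (proj₂ best) j)

      -- `f` is the sum over a fibre and `h` its budget: the part q of each factor q + bit is paid
      -- at the nodes, while the bits are charged to the edges.
      f h : Vec (Fin (suc r)) n → ℕ
      f w = sum (λ x → weight q (G (x ∷ w)))
      h w = sum (λ x → q * weight q (node x w)) + sum (λ j → weight q (edge j w))

      vsum-f : vsum (suc n) (weight q ∘ G) ≡ vsum n f
      vsum-f = sym (vsum-sum n (λ x w → weight q (G (x ∷ w))))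

      vsum-h : vsum n h ≤ m * M
      vsum-h = begin
        vsum n h
          ≡⟨ vsum-+ n _ _ ⟩
        vsum n (λ w → sum (λ x → q * weight q (node x w))) + vsum n (λ w → sum (λ j → weight q (edge j w)))
          ≡⟨ cong₂ _+_ (vsum-sum n (λ x w → q * weight q (node x w))) (vsum-sum n (λ j w → weight q (edge j w))) ⟩
        sum (λ x → vsum n (λ w → q * weight q (node x w))) + sum (λ j → vsum n (weight q ∘ edge j))
          ≤⟨ +-mono-≤ (sum≤* (λ x → ≤-trans (≤-reflexive (vsum-* n q (weight q ∘ node x))) (*-monoʳ-≤ q (node≤M x))))
                      (sum≤* edge≤M) ⟩
        suc r * (q * M) + r * M
          ≡⟨ count r q M ⟩
        m * M ∎
        where
        open ≤-Reasoning
        -- There are r + 1 nodes paying q each and r edges paying 1 each.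
        count : ∀ r q M → suc r * (q * M) + r * M ≡ (q + r * suc q) * M
        count = solve-∀

      -- An unmarked node contributes no bit, so it can be the zero from which all other nodes are
      -- charged to edges.
      f≤h : ∀ w x → head (G (x ∷ w)) ≢ true → f w ≤ h w
      f≤h w x x-unmarked = begin
        f w
          ≡⟨ sum-cong-≗ (λ y → trans (weight-head q (G (y ∷ w))) (*-distribʳ-+ (weight q (node y w)) q _)) ⟩
        sum (λ y → q * weight q (node y w) + e y)
          ≡⟨ ∑-distrib-+ (λ y → q * weight q (node y w)) e ⟩
        sum (λ y → q * weight q (node y w)) + sum e
          ≤⟨ +-monoʳ-≤ _ (≤-trans (sum≤sum-edges e x ex≡0) (sum-mono (λ j → ⊔-lub
               (≤-trans (e≤ (inject₁ j)) (weight-∨ˡ q (node (inject₁ j) w) (node (suc j) w)))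
               (≤-trans (e≤ (suc j)) (weight-∨ʳ q (node (inject₁ j) w) (node (suc j) w)))))) ⟩
        h w ∎
        where
        open ≤-Reasoning
        e : Fin (suc r) → ℕ
        e y = bit (head (G (y ∷ w))) * weight q (node y w)
        ex≡0 : e x ≡ 0
        ex≡0 with head (G (x ∷ w))
        ... | true  = contradiction refl x-unmarked
        ... | false = refl
        e≤ : ∀ y → e y ≤ weight q (node y w)
        e≤ y with head (G (y ∷ w))
        ... | true  = ≤-reflexive (+-identityʳ _)
        ... | false = z≤n

      conclude : vsum n f ≤ vsum n h ⊎ (∃ λ w → h w < f w) →
        Σ (Vec Bool (suc n)) λ H → (∀ i → lookup H i ≡ true → Sweep G i) × vsum (suc n) (weight q ∘ G) ≤ weight m H
      conclude (inj₁ le) = false ∷ H , (λ { (suc i) p → proj₂ (proj₁ best) i p }) , (begin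
        vsum (suc n) (weight q ∘ G) ≡⟨ vsum-f ⟩
        vsum n f                    ≤⟨ le ⟩
        vsum n h                    ≤⟨ vsum-h ⟩
        m * M                       ≡⟨ cong (_* M) (+-identityʳ m) ⟨
        (m + 0) * M                 ∎)
        where open ≤-Reasoning
      -- By `f≤h` every node over `w` is marked in the first direction. Each slice is bounded with q
      -- + 1 in place of q + bit, and (r+1)(q+1) is `suc m` by computation.
      conclude (inj₂ (w , h<f)) =
        true ∷ H , (λ { zero _ → full ; (suc i) p → proj₂ (proj₁ best) i p }) , (begin
        sum (λ x → vsum n (λ w → weight q (G (x ∷ w)))) ≤⟨ sum≤* slice≤ ⟩
        suc r * (suc q * M)                             ≡⟨ *-assoc (suc r) (suc q) M ⟨
        suc m * M                                       ≡⟨ cong (_* M) (+-comm 1 m) ⟩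
        (m + 1) * M                                     ∎)
        where
        open ≤-Reasoning
        marked : ∀ x → head (G (x ∷ w)) ≡ true
        marked x with head (G (x ∷ w)) Bool.≟ true
        ... | yes p = p
        ... | no ¬p = contradiction (f≤h w x ¬p) (<⇒≱ h<f)
        lookup-zero : ∀ (v : Vec Bool (suc n)) → lookup v zero ≡ head v
        lookup-zero (b ∷ v) = refl
        full : Sweep G zero
        full = record
          { pt     = _∷ w
          ; at     = λ _ → refl
          ; marked = λ x → trans (lookup-zero (G (x ∷ w))) (marked x)
          ; near   = λ { x y zero z≢z → contradiction refl z≢z ; x y (suc l) _ → inj₁ refl }
          }
        bit≤1 : ∀ b → bit b ≤ 1
        bit≤1 true  = ≤-refl
        bit≤1 false = z≤n
        slice≤ : ∀ x → vsum n (λ w → weight q (G (x ∷ w))) ≤ suc q * M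
        slice≤ x = begin
          vsum n (λ w → weight q (G (x ∷ w)))
            ≤⟨ vsum-mono n (λ w → ≤-trans (≤-reflexive (weight-head q (G (x ∷ w))))
                 (*-monoˡ-≤ (weight q (node x w)) (≤-trans (+-monoʳ-≤ q (bit≤1 (head (G (x ∷ w))))) (≤-reflexive (+-comm q 1))))) ⟩
          vsum n (λ w → suc q * weight q (node x w))
            ≡⟨ vsum-* n (suc q) (weight q ∘ node x) ⟩
          suc q * vsum n (weight q ∘ node x)
            ≤⟨ *-monoʳ-≤ (suc q) (node≤M x) ⟩
          suc q * M ∎

  -- Combinatorial batons, and richness of a product of levels.

  module _ {k : ℕ} where

    -- Away from `i` only consecutive points are constrained: the bounds for other pairs follow by
    -- adding steps, and direction `i` supplies the exact distances.
    record Baton {q n} (e : Fin (suc k) → Fin (suc q)) (Step : Fin k → Fin (suc q) → Fin (suc q) → Set)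
                 (S : Vec (Fin (suc q)) n → Bool) (i : Fin n) : Set where
      field
        pt   : Fin (suc k) → Vec (Fin (suc q)) n
        mem  : ∀ j → S (pt j) ≡ true
        at   : ∀ j → lookup (pt j) i ≡ e j
        step : ∀ j l → l ≢ i → Step j (lookup (pt (inject₁ j)) l) (lookup (pt (suc j)) l)

    -- Stronger than the existence of one baton, so that it can be fed into `sweeps`: a whole set of
    -- directions carrying batons is returned, and its weight bounds the count.
    Rich : ∀ q → (Fin (suc k) → Fin (suc q)) → (Fin k → Fin (suc q) → Fin (suc q) → Set) → Set
    Rich q e Step = ∀ n (S : Vec (Fin (suc q)) n → Bool) →
      Σ (Vec Bool n) λ G → (∀ i → lookup G i ≡ true → Baton e Step S i) × vsum n (bit ∘ S) ≤ weight q G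

    -- With one letter the cube is a single point. If it lies in `S`, repeating it is a baton in
    -- every direction and the weight is 1; if not, the count is 0 and nothing is marked.
    rich-point : ∀ {Step} → (∀ j → Step j zero zero) → Rich 0 (λ _ → zero) Step
    rich-point {Step} step n S = replicate n b , baton , ≤-trans (≤-reflexive (vsum-point n (bit ∘ S))) (bit≤weight b n)
      where
      b = S (replicate n zero)
      vsum-point : ∀ n (f : Vec (Fin 1) n → ℕ) → vsum n f ≡ f (replicate n zero)
      vsum-point zero    f = refl
      vsum-point (suc n) f = trans (+-identityʳ _) (vsum-point n (f ∘ (zero ∷_)))
      bit≤weight : ∀ b n → bit b ≤ weight 0 (replicate n b)
      bit≤weight false n       = z≤n
      bit≤weight true  zero    = ≤-refl
      bit≤weight true  (suc n) = ≤-trans (bit≤weight true n) (≤-reflexive (sym (+-identityʳ _)))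
      baton : ∀ i → lookup (replicate n b) i ≡ true → Baton (λ _ → zero) Step S i
      baton i p = record
        { pt   = λ _ → replicate n zero
        ; mem  = λ _ → trans (sym (lookup-replicate i b)) p
        ; at   = λ _ → lookup-replicate i zero
        ; step = λ j l _ → subst (λ x → Step j x x) (sym (lookup-replicate l zero)) (step j)
        }

    -- Richness of the lower level attaches to each row a set of directions, and `sweeps` is applied
    -- to that function. The baton takes its `j`-th point from the row over the `j`-th mark of the
    -- path. Each step either stays in one row, where the lower baton controls it, or tolerates
    -- arbitrary lower letters.
    rich-product : ∀ r q {eᵀ : Fin (suc k) → Fin (suc r)} {e : Fin (suc k) → Fin (suc q)} {Step Step′} →
      (∀ j → (eᵀ (inject₁ j) ≡ eᵀ (suc j) × (∀ (x : Fin (suc r)) {y y′} → Step j y y′ → Step′ j (combine x y) (combine x y′)))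
           ⊎ (∀ {x x′ : Fin (suc r)} y y′ → Near x x′ → Step′ j (combine x y) (combine x′ y′))) →
      Rich q e Step → Rich (q + r * suc q) (λ j → combine {suc r} {suc q} (eᵀ j) (e j)) Step′
    rich-product r q {eᵀ} {e} {Step} {Step′} steps rich n S = H , baton , (begin
        vsum n (bit ∘ S)
          ≡⟨ vsum-combine (suc r) (suc q) n (bit ∘ S) ⟩
        vsum {suc r} n (λ t → vsum {suc q} n (bit ∘ row t))
          ≤⟨ vsum-mono n (λ t → proj₂ (proj₂ (rich n (row t)))) ⟩
        vsum n (weight q ∘ G)
          ≤⟨ proj₂ (proj₂ swept) ⟩
        weight (q + r * suc q) H ∎)
      where
      open ≤-Reasoning
      row : Vec (Fin (suc r)) n → Vec (Fin (suc q)) n → Bool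
      row t u = S (zipWith combine t u)
      G : Vec (Fin (suc r)) n → Vec Bool n
      G t = proj₁ (rich n (row t))
      swept = sweeps q n G
      H = proj₁ swept

      baton : ∀ i → lookup H i ≡ true → Baton (λ j → combine {suc r} {suc q} (eᵀ j) (e j)) Step′ S i
      baton i Hi = record
        { pt   = λ j → zipWith (combine {suc r} {suc q}) (pt (eᵀ j)) (B.pt (eᵀ j) j)
        ; mem  = λ j → B.mem (eᵀ j) j
        ; at   = λ j → trans (lookup-zipWith (combine {suc r} {suc q}) i (pt (eᵀ j)) (B.pt (eᵀ j) j)) (cong₂ (combine {suc r} {suc q}) (at (eᵀ j)) (B.at (eᵀ j) j))
        ; step = step′
        }
        where
        open Sweep (proj₁ (proj₂ swept) i Hi)
        module B x = Baton (proj₁ (proj₂ (rich n (row (pt x)))) i (marked x))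
        step′ : ∀ j l → l ≢ i →
          Step′ j (lookup (zipWith (combine {suc r} {suc q}) (pt (eᵀ (inject₁ j))) (B.pt (eᵀ (inject₁ j)) (inject₁ j))) l)
                  (lookup (zipWith (combine {suc r} {suc q}) (pt (eᵀ (suc j))) (B.pt (eᵀ (suc j)) (suc j))) l)
        step′ j l l≢i
          rewrite lookup-zipWith (combine {suc r} {suc q}) l (pt (eᵀ (inject₁ j))) (B.pt (eᵀ (inject₁ j)) (inject₁ j))
                | lookup-zipWith (combine {suc r} {suc q}) l (pt (eᵀ (suc j))) (B.pt (eᵀ (suc j)) (suc j))
          with steps j
        ... | inj₁ (same , lift) rewrite same = lift (lookup (pt (eᵀ (suc j))) l) (B.step (eᵀ (suc j)) j l l≢i)
        -- The two points may come from batons of different rows, so nothing relates their lower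
        -- letters.
        ... | inj₂ cross = cross (lookup (B.pt (eᵀ (inject₁ j)) (inject₁ j)) l) (lookup (B.pt (eᵀ (suc j)) (suc j)) l)
                                (near (eᵀ (inject₁ j)) (eᵀ (suc j)) l l≢i)

  -- Counting the points of a list without repetitions.

  module _ {k n : ℕ} where

    open DecMembership (≡-dec {n = n} (Fin._≟_ {k})) using (_∈?_)

    indicator : List (Vec (Fin k) n) → Vec (Fin k) n → Bool
    indicator B v = does (v ∈? B)

    indicator⇒∈ : ∀ B v → indicator B v ≡ true → v ∈ B
    indicator⇒∈ B v p with v ∈? B
    ... | yes v∈B = v∈B

    -- Every entry contributes its point mass `δ`, and uniqueness keeps these masses disjoint.
    length≤vsum : ∀ B → Unique B → length B ≤ vsum n (bit ∘ indicator B)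
    length≤vsum []      []             = z≤n
    length≤vsum (b ∷ B) (b∉B ∷ unique) = begin
      1 + length B
        ≤⟨ +-mono-≤ (subst (λ c → bit c ≤ vsum n δ) (dec-true (b ≟ᵛ b) refl) (≤-vsum n δ b)) (length≤vsum B unique) ⟩
      vsum n δ + vsum n (bit ∘ indicator B)
        ≡⟨ vsum-+ n δ (bit ∘ indicator B) ⟨
      vsum n (λ v → δ v + bit (indicator B v))
        ≤⟨ vsum-mono n disjoint ⟩
      vsum n (bit ∘ indicator (b ∷ B)) ∎
      where
      open ≤-Reasoning
      _≟ᵛ_ = ≡-dec {n = n} (Fin._≟_ {k})
      δ : Vec (Fin k) n → ℕ
      δ v = bit (does (v ≟ᵛ b))
      ≤-sum : ∀ {l} (f : Fin l → ℕ) i → f i ≤ sum f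
      ≤-sum f zero    = m≤m+n (f zero) _
      ≤-sum f (suc i) = ≤-trans (≤-sum (f ∘ suc) i) (m≤n+m _ (f zero))
      ≤-vsum : ∀ n (f : Vec (Fin k) n → ℕ) v → f v ≤ vsum n f
      ≤-vsum zero    f []      = ≤-refl
      ≤-vsum (suc n) f (c ∷ v) = ≤-trans (≤-vsum n (f ∘ (c ∷_)) v) (≤-sum (λ d → vsum n (f ∘ (d ∷_))) c)
      disjoint : ∀ v → δ v + bit (indicator B v) ≤ bit (indicator (b ∷ B) v)
      disjoint v with v ≟ᵛ b | v ∈? B
      ... | yes refl | yes b∈B = contradiction refl (List.lookup b∉B b∈B)
      ... | yes _    | no  _   = ≤-refl
      ... | no  _    | _       = ≤-refl

  module _ {k q : ℕ} {e : Fin (suc k) → Fin (suc q)} {Step : Fin k → Fin (suc q) → Fin (suc q) → Set} where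

    -- If no direction were marked, the weight would be exactly q^n, too small for the points of
    -- `B`.
    rich⇒baton : Rich q e Step → ∀ n (B : List (Vec (Fin (suc q)) n)) → Unique B → q ^ n < length B →
                 ∃ λ i → Baton e Step (indicator B) i
    rich⇒baton rich n B unique q^n<∣B∣ with rich n (indicator B)
    ... | G , baton , count≤ with Fin.any? (λ i → lookup G i Bool.≟ true)
    ...   | yes (i , Gi) = i , baton i Gi
    ...   | no  none     = contradiction q^n<∣B∣ (≤⇒≯ (≤-trans (length≤vsum B unique)
                             (≤-trans count≤ (≤-reflexive (weight-false q G (λ i Gi → none (i , Gi)))))))

module OrderedField (R : RealField) where

  open import Data.Nat using (s≤s) renaming (_+_ to _+ℕ_; _*_ to _*ℕ_)
  open Combinatorics
  open RealField R

  -- Ordered field arithmetic.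

  commutativeRing : CommutativeRing _ _
  commutativeRing = record { isCommutativeRing = isCommutativeRing }
    where
    isCommutativeRing : IsCommutativeRing _≡_ _+_ _*_ -_ 0ℝ 1ℝ
    isCommutativeRing = record
      { isRing = record
        { +-isAbelianGroup = record
          { isGroup = record
            { isMonoid = record
              { isSemigroup = record
                { isMagma = record { isEquivalence = isEquivalence ; ∙-cong = cong₂ _+_ } ; assoc = +-assoc }
              ; identity = (λ x → trans (+-comm 0ℝ x) (+-identityʳ x)) , +-identityʳ
              }
            ; inverse = (λ x → trans (+-comm (- x) x) (+-inverseʳ x)) , +-inverseʳ
            ; ⁻¹-cong = cong (λ x → - x)
            }
          ; comm = +-comm
          }
        ; *-cong = cong₂ _*_
        ; *-assoc = *-assoc
        ; *-identity = (λ x → trans (*-comm 1ℝ x) (*-identityʳ x)) , *-identityʳ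
        ; distrib = distribˡ , λ x y z → trans (*-comm (y + z) x) (trans (distribˡ x y z) (cong₂ _+_ (*-comm x y) (*-comm x z)))
        }
      ; *-comm = *-comm
      }

  open CommutativeRing commutativeRing using (ring; +-commutativeMonoid; +-identityˡ)
  open Algebra.Properties.Ring ring using (-1*x≈-x; -‿involutive; -‿+-comm; +-cancelˡ)
  open Algebra.Solver.CommutativeMonoid +-commutativeMonoid using (solve; _⊕_; _⊜_)

  private module NonStrict = Relation.Binary.Construct.StrictToNonStrict _≡_ _<_

  ≤-refl : ∀ {x} → x ≤ x
  ≤-refl = inj₂ refl

  ≤-reflexive : ∀ {x y} → x ≡ y → x ≤ y
  ≤-reflexive = inj₂

  ≤-trans : ∀ {x y z} → x ≤ y → y ≤ z → x ≤ z
  ≤-trans = NonStrict.trans isEquivalence (resp₂ _<_) <-trans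

  <-≤-trans : ∀ {x y z} → x < y → y ≤ z → x < z
  <-≤-trans = NonStrict.<-≤-trans <-trans (proj₁ (resp₂ _<_))

  ≤-<-trans : ∀ {x y z} → x ≤ y → y < z → x < z
  ≤-<-trans = NonStrict.≤-<-trans sym <-trans (proj₂ (resp₂ _<_))

  <⇒≢ : ∀ {x y} → x < y → x ≢ y
  <⇒≢ x<y refl = <-irrefl _ x<y

  ≤⇒≯ : ∀ {x y} → x ≤ y → ¬ (y < x)
  ≤⇒≯ x≤y y<x = <-irrefl _ (<-≤-trans y<x x≤y)

  _<?≤_ : ∀ x y → x < y ⊎ y ≤ x
  x <?≤ y with <-tri x y
  ... | tri< x<y _ _ = inj₁ x<y
  ... | tri≈ _ x≡y _ = inj₂ (inj₂ (sym x≡y))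
  ... | tri> _ _ y<x = inj₂ (inj₁ y<x)

  +-monoˡ-≤ : ∀ z {x y} → x ≤ y → x + z ≤ y + z
  +-monoˡ-≤ z (inj₁ x<y) = inj₁ (+-mono-< z x<y)
  +-monoˡ-≤ z (inj₂ refl) = ≤-refl

  +-monoʳ-≤ : ∀ z {x y} → x ≤ y → z + x ≤ z + y
  +-monoʳ-≤ z {x} {y} x≤y = subst₂ _≤_ (+-comm x z) (+-comm y z) (+-monoˡ-≤ z x≤y)

  +-monoʳ-< : ∀ z {x y} → x < y → z + x < z + y
  +-monoʳ-< z {x} {y} x<y = subst₂ _<_ (+-comm x z) (+-comm y z) (+-mono-< z x<y)

  +-mono-≤ : ∀ {x y u v} → x ≤ y → u ≤ v → x + u ≤ y + v
  +-mono-≤ {y = y} {u} x≤y u≤v = ≤-trans (+-monoˡ-≤ u x≤y) (+-monoʳ-≤ y u≤v)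

  +-nonneg : ∀ {x y} → 0ℝ ≤ x → 0ℝ ≤ y → 0ℝ ≤ x + y
  +-nonneg {x} {y} 0≤x 0≤y = subst (_≤ x + y) (+-identityʳ 0ℝ) (+-mono-≤ 0≤x 0≤y)

  x≤x+y : ∀ x {y} → 0ℝ ≤ y → x ≤ x + y
  x≤x+y x {y} 0≤y = subst (_≤ x + y) (+-identityʳ x) (+-monoʳ-≤ x 0≤y)

  y≤x+y : ∀ {x} y → 0ℝ ≤ x → y ≤ x + y
  y≤x+y {x} y 0≤x = subst (y ≤_) (+-comm y x) (x≤x+y y 0≤x)

  x+x<y+y⇒x<y : ∀ {x y} → x + x < y + y → x < y
  x+x<y+y⇒x<y {x} {y} lt with x <?≤ y
  ... | inj₁ x<y = x<y
  ... | inj₂ y≤x = contradiction lt (≤⇒≯ (+-mono-≤ y≤x y≤x))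

  x+x≤y+y⇒x≤y : ∀ {x y} → x + x ≤ y + y → x ≤ y
  x+x≤y+y⇒x≤y {x} {y} le with y <?≤ x
  ... | inj₂ x≤y = x≤y
  ... | inj₁ y<x = contradiction (<-trans (+-mono-< y y<x) (+-monoʳ-< x y<x)) (≤⇒≯ le)

  0<1 : 0ℝ < 1ℝ
  0<1 with <-tri 0ℝ 1ℝ
  ... | tri< 0<1 _ _ = 0<1
  ... | tri≈ _ 0≡1 _ = contradiction 0≡1 0≢1
  -- Here -1 is positive, hence so is its square, which is 1.
  ... | tri> _ _ 1<0 = subst (0ℝ <_) (trans (-1*x≈-x (- 1ℝ)) (-‿involutive 1ℝ)) (*-pos 0<-1 0<-1)
    where
    0<-1 : 0ℝ < - 1ℝ
    0<-1 = subst₂ _<_ (+-inverseʳ 1ℝ) (+-identityˡ (- 1ℝ)) (+-mono-< (- 1ℝ) 1<0)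

  -- Halving, doubling and distances on the line.

  half : ℝ → ℝ
  half x = x * (1ℝ + 1ℝ) ⁻¹

  half+half : ∀ x → half x + half x ≡ x
  half+half x = trans (sym (distribˡ x h h)) (trans (cong (x *_) h+h≡1) (*-identityʳ x))
    where
    h = (1ℝ + 1ℝ) ⁻¹
    2≢0 : ¬ (1ℝ + 1ℝ ≡ 0ℝ)
    2≢0 2≡0 = <-irrefl 0ℝ (subst (0ℝ <_) 2≡0 (<-≤-trans 0<1 (x≤x+y 1ℝ (inj₁ 0<1))))
    h+h≡1 : h + h ≡ 1ℝ
    h+h≡1 = trans (cong₂ _+_ (sym (*-identityʳ h)) (sym (*-identityʳ h)))
            (trans (sym (distribˡ h 1ℝ 1ℝ)) (trans (*-comm h (1ℝ + 1ℝ)) (*-inverseʳ (1ℝ + 1ℝ) 2≢0)))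

  half-pos : ∀ {x} → 0ℝ < x → 0ℝ < half x
  half-pos {x} 0<x = x+x<y+y⇒x<y (subst₂ _<_ (sym (+-identityʳ 0ℝ)) (sym (half+half x)) 0<x)

  -- 2ⁿ x
  dbl : ℕ → ℝ → ℝ
  dbl zero    x = x
  dbl (suc n) x = dbl n (x + x)

  dbl-+ : ∀ n x y → dbl n (x + y) ≡ dbl n x + dbl n y
  dbl-+ zero    x y = refl
  dbl-+ (suc n) x y = trans (cong (dbl n) (solve 2 (λ x y → (x ⊕ y) ⊕ (x ⊕ y) ⊜ (x ⊕ x) ⊕ (y ⊕ y)) refl x y))
                            (dbl-+ n (x + x) (y + y))

  dbl-dbl : ∀ m n x → dbl m (dbl n x) ≡ dbl (n +ℕ m) x
  dbl-dbl m zero    x = refl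
  dbl-dbl m (suc n) x = dbl-dbl m n (x + x)

  dbl-mono : ∀ n {x y} → x ≤ y → dbl n x ≤ dbl n y
  dbl-mono zero    x≤y = x≤y
  dbl-mono (suc n) x≤y = dbl-mono n (+-mono-≤ x≤y x≤y)

  x≤dbl : ∀ n {x} → 0ℝ ≤ x → x ≤ dbl n x
  x≤dbl zero        0≤x = ≤-refl
  x≤dbl (suc n) {x} 0≤x = ≤-trans (x≤x+y x 0≤x) (x≤dbl n (+-nonneg 0≤x 0≤x))

  -- This is |x - y| ≤ c, written without subtraction so that monotonicity of addition settles the
  -- estimates.
  Close : ℝ → ℝ → ℝ → Set
  Close x y c = x ≤ y + c × y ≤ x + c

  close-refl : ∀ x {c} → 0ℝ ≤ c → Close x x c
  close-refl x 0≤c = x≤x+y x 0≤c , x≤x+y x 0≤c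

  close-sym : ∀ {x y c} → Close x y c → Close y x c
  close-sym (p , q) = q , p

  close-mono : ∀ {x y c d} → c ≤ d → Close x y c → Close x y d
  close-mono {x} {y} c≤d (p , q) = ≤-trans p (+-monoʳ-≤ y c≤d) , ≤-trans q (+-monoʳ-≤ x c≤d)

  close-+ : ∀ {x y u v c d} → Close x y c → Close u v d → Close (x + u) (y + v) (c + d)
  close-+ {x} {y} {u} {v} {c} {d} (p , q) (p′ , q′) =
      ≤-trans (+-mono-≤ p p′) (≤-reflexive (swap y c v d))
    , ≤-trans (+-mono-≤ q q′) (≤-reflexive (swap x c u d))
    where
    swap : ∀ a b c d → (a + b) + (c + d) ≡ (a + c) + (b + d)
    swap = solve 4 (λ a b c d → (a ⊕ b) ⊕ (c ⊕ d) ⊜ (a ⊕ c) ⊕ (b ⊕ d)) refl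

  close-trans : ∀ {x y z c d} → Close x y c → Close y z d → Close x z (c + d)
  close-trans {x} {y} {z} {c} {d} (p , q) (p′ , q′) =
      ≤-trans p (≤-trans (+-monoˡ-≤ c p′) (≤-reflexive (solve 3 (λ z d c → (z ⊕ d) ⊕ c ⊜ z ⊕ (c ⊕ d)) refl z d c)))
    , ≤-trans q′ (≤-trans (+-monoˡ-≤ d q) (≤-reflexive (+-assoc x c d)))

  close-interval : ∀ {x y D} → 0ℝ ≤ x → x ≤ D → 0ℝ ≤ y → y ≤ D → Close x y D
  close-interval {x} {y} {D} 0≤x x≤D 0≤y y≤D = ≤-trans x≤D (y≤x+y D 0≤y) , ≤-trans y≤D (y≤x+y D 0≤x)

  y+c-y : ∀ y c → (y + c) - y ≡ c
  y+c-y y c = trans (cong (_- y) (+-comm y c)) (trans (+-assoc c y (- y)) (trans (cong (c +_) (+-inverseʳ y)) (+-identityʳ c)))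

  close⇒AbsLe : ∀ {x y c} → Close x y c → AbsLe R (x - y) c
  close⇒AbsLe {x} {y} {c} (p , q) =
      subst₂ _≤_ (trans (cong (_+ (- c)) (+-comm (- y) y)) (trans (cong (_+ (- c)) (+-inverseʳ y)) (+-identityˡ (- c))))
        lemma (+-monoˡ-≤ (- c) (+-monoʳ-≤ (- y) q))
    , subst (x - y ≤_) (y+c-y y c) (+-monoˡ-≤ (- y) p)
    where
    lemma : (- y + (x + c)) + (- c) ≡ x - y
    lemma = trans (cong (_- c) (trans (sym (+-assoc (- y) x c)) (trans (+-comm (- y + x) c) (cong (c +_) (+-comm (- y) x)))))
                  (y+c-y c (x - y))

  -- Sums of steps.

  total : ∀ {k} → (Fin k → ℝ) → ℝ
  total {zero}  β = 0ℝ
  total {suc k} β = β zero + total (β ∘ suc)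

  total-nonneg : ∀ {k} {β : Fin k → ℝ} → (∀ j → 0ℝ ≤ β j) → 0ℝ ≤ total β
  total-nonneg {zero}  0≤β = ≤-refl
  total-nonneg {suc k} 0≤β = +-nonneg (0≤β zero) (total-nonneg (0≤β ∘ suc))

  total-+ : ∀ {k} {α β γ : Fin k → ℝ} → (∀ j → γ j ≡ α j + β j) → total γ ≡ total α + total β
  total-+ {zero}  eq = sym (+-identityʳ 0ℝ)
  total-+ {suc k} eq = trans (cong₂ _+_ (eq zero) (total-+ (eq ∘ suc)))
    (solve 4 (λ a b c d → (a ⊕ b) ⊕ (c ⊕ d) ⊜ (a ⊕ c) ⊕ (b ⊕ d)) refl _ _ _ _)

  -- The crude k ≤ 2^k suffices, and it keeps the estimates in terms of doublings.
  total≤dbl : ∀ {k} {β : Fin k → ℝ} {b} → 0ℝ ≤ b → (∀ j → β j ≤ b) → total β ≤ dbl k b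
  total≤dbl {zero}          0≤b β≤b = 0≤b
  total≤dbl {suc k} {b = b} 0≤b β≤b =
    ≤-trans (+-mono-≤ (≤-trans (β≤b zero) (x≤dbl k 0≤b)) (total≤dbl 0≤b (β≤b ∘ suc))) (≤-reflexive (sym (dbl-+ k b b)))

  -- Refutes `g ≤ total α + total α` for positive `g` once no positive step remains.
  total+total≤0 : ∀ {k} {β : Fin k → ℝ} → (∀ j → β j ≤ 0ℝ) → total β + total β ≤ 0ℝ
  total+total≤0 β≤0 = ≤-trans (+-mono-≤ (total≤0 β≤0) (total≤0 β≤0)) (≤-reflexive (+-identityʳ 0ℝ))
    where
    total≤0 : ∀ {k} {β : Fin k → ℝ} → (∀ j → β j ≤ 0ℝ) → total β ≤ 0ℝ
    total≤0 {zero}  β≤0 = ≤-refl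
    total≤0 {suc k} β≤0 = ≤-trans (+-mono-≤ (β≤0 zero) (total≤0 (β≤0 ∘ suc))) (≤-reflexive (+-identityʳ 0ℝ))

  partialSum-+ : ∀ {k} {α β γ : Fin k → ℝ} → (∀ j → γ j ≡ α j + β j) →
                 ∀ j → partialSum R k γ j ≡ partialSum R k α j + partialSum R k β j
  partialSum-+ {zero}  eq zero    = sym (+-identityʳ 0ℝ)
  partialSum-+ {suc k} eq zero    = sym (+-identityʳ 0ℝ)
  partialSum-+ {suc k} eq (suc j) = trans (cong₂ _+_ (eq zero) (partialSum-+ (eq ∘ suc) j))
    (solve 4 (λ a b c d → (a ⊕ b) ⊕ (c ⊕ d) ⊜ (a ⊕ c) ⊕ (b ⊕ d)) refl _ _ _ _)

  partialSum-zero : ∀ {k} {β : Fin k → ℝ} → (∀ j → β j ≡ 0ℝ) → ∀ j → partialSum R k β j ≡ 0ℝ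
  partialSum-zero {zero}  β≡0 zero    = refl
  partialSum-zero {suc k} β≡0 zero    = refl
  partialSum-zero {suc k} β≡0 (suc j) = trans (cong₂ _+_ (β≡0 zero) (partialSum-zero (β≡0 ∘ suc) j)) (+-identityʳ 0ℝ)

  -- Paths on the line with prescribed gaps.

  pos : ∀ {r} → Vec ℝ r → Fin (suc r) → ℝ
  pos hs       zero    = 0ℝ
  pos (h ∷ hs) (suc i) = h + pos hs i

  -- `D` will bound the diameter of the lower levels. Gaps above `D` keep their translates disjoint,
  -- and gaps of at most `g` make a move to a near node cheap. Since 2D < g, halving a length above
  -- `g` leaves more than `D`.
  module Path {D g : ℝ} (0≤D : 0ℝ ≤ D) (D+D<g : D + D < g) where

    Gaps : ∀ {r} → Vec ℝ r → Set
    Gaps = All (λ h → D < h × h ≤ g)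

    0≤g : 0ℝ ≤ g
    0≤g = ≤-trans (+-nonneg 0≤D 0≤D) (inj₁ D+D<g)

    D≤g : D ≤ g
    D≤g = ≤-trans (x≤x+y D 0≤D) (inj₁ D+D<g)

    gap-nonneg : ∀ {h} → D < h × h ≤ g → 0ℝ ≤ h
    gap-nonneg (D<h , _) = ≤-trans 0≤D (inj₁ D<h)

    pos-nonneg : ∀ {r} {hs : Vec ℝ r} → Gaps hs → ∀ i → 0ℝ ≤ pos hs i
    pos-nonneg gaps       zero    = ≤-refl
    pos-nonneg (p ∷ gaps) (suc i) = +-nonneg (gap-nonneg p) (pos-nonneg gaps i)

    pos-≤-total : ∀ {r} {hs : Vec ℝ r} → Gaps hs → ∀ i → pos hs i ≤ total (lookup hs)
    pos-≤-total {hs = hs} gaps zero = total-nonneg (lookup-nonneg gaps)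
      where
      lookup-nonneg : ∀ {r} {hs : Vec ℝ r} → Gaps hs → ∀ i → 0ℝ ≤ lookup hs i
      lookup-nonneg (p ∷ gaps) zero    = gap-nonneg p
      lookup-nonneg (p ∷ gaps) (suc i) = lookup-nonneg gaps i
    pos-≤-total {hs = h ∷ hs} (p ∷ gaps) (suc i) = +-monoʳ-≤ h (pos-≤-total gaps i)

    pos-edge : ∀ {r} {hs : Vec ℝ r} → Gaps hs → ∀ j → Close (pos hs (inject₁ j)) (pos hs (suc j)) g
    pos-edge {hs = h ∷ hs} (p@(_ , h≤g) ∷ gaps) zero rewrite +-identityʳ h =
      +-nonneg (gap-nonneg p) 0≤g , subst (h ≤_) (sym (+-identityˡ g)) h≤g
    pos-edge {hs = h ∷ hs} (_ ∷ gaps) (suc j) =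
      let l , u = pos-edge gaps j in shift l , shift u
      where
      shift : ∀ {x y} → x ≤ y + g → h + x ≤ (h + y) + g
      shift {y = y} le = ≤-trans (+-monoʳ-≤ h le) (≤-reflexive (sym (+-assoc h y g)))

    pos-near : ∀ {r} {hs : Vec ℝ r} → Gaps hs → ∀ {x y} → Near x y → Close (pos hs x) (pos hs y) g
    pos-near gaps (inj₁ refl) = close-refl _ 0≤g
    pos-near gaps (inj₂ (j , inj₁ refl , inj₁ refl)) = close-refl _ 0≤g
    pos-near gaps (inj₂ (j , inj₁ refl , inj₂ refl)) = pos-edge gaps j
    pos-near gaps (inj₂ (j , inj₂ refl , inj₁ refl)) = close-sym (pos-edge gaps j)
    pos-near gaps (inj₂ (j , inj₂ refl , inj₂ refl)) = close-refl _ 0≤g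

    pos-separated : ∀ {r} {hs : Vec ℝ r} → Gaps hs → ∀ {x y} → x Fin.< y → pos hs x + D < pos hs y
    pos-separated {hs = h ∷ hs} ((D<h , _) ∷ gaps) {zero} {suc y} _ =
      subst (_< h + pos hs y) (sym (+-identityˡ D)) (<-≤-trans D<h (x≤x+y h (pos-nonneg gaps y)))
    pos-separated {hs = h ∷ hs} (_ ∷ gaps) {suc x} {suc y} (s≤s x<y) =
      subst (_< h + pos hs y) (sym (+-assoc h (pos hs x) D)) (+-monoʳ-< h (pos-separated gaps x<y))

    record Extension (x : ℝ) {r} (hs : Vec ℝ r) : Set where
      field
        {size}  : ℕ
        hs′     : Vec ℝ size
        gaps′   : Gaps hs′
        emb     : Fin (suc r) → Fin (suc size)
        pos-emb : ∀ i → pos hs′ (emb i) ≡ x + pos hs i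
        total′  : total (lookup hs′) ≡ x + total (lookup hs)

    -- Halve until the length is at most `g`. The exponent `N` bounds the depth in advance and so
    -- takes the place of the Archimedean property.
    subdivide : ∀ N x → D < x → x ≤ dbl N g → ∀ {r} {hs : Vec ℝ r} → Gaps hs → Extension x hs
    subdivide zero x D<x x≤g {hs = hs} gaps = record
      { hs′ = x ∷ hs ; gaps′ = (D<x , x≤g) ∷ gaps ; emb = suc ; pos-emb = λ _ → refl ; total′ = refl }
    subdivide (suc N) x D<x x≤ {hs = hs} gaps with g <?≤ x
    ... | inj₂ x≤g = record
      { hs′ = x ∷ hs ; gaps′ = (D<x , x≤g) ∷ gaps ; emb = suc ; pos-emb = λ _ → refl ; total′ = refl }
    ... | inj₁ g<x = record
      { hs′ = E₂.hs′ ; gaps′ = E₂.gaps′ ; emb = E₂.emb ∘ E₁.emb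
      ; pos-emb = λ i → trans (E₂.pos-emb (E₁.emb i)) (join (E₁.pos-emb i))
      ; total′ = trans E₂.total′ (join E₁.total′)
      }
      where
      D<h : D < half x
      D<h = x+x<y+y⇒x<y (<-trans D+D<g (subst (g <_) (sym (half+half x)) g<x))
      h≤ : half x ≤ dbl N g
      h≤ = x+x≤y+y⇒x≤y (subst₂ _≤_ (sym (half+half x)) (dbl-+ N g g) x≤)
      module E₁ = Extension (subdivide N (half x) D<h h≤ gaps)
      module E₂ = Extension (subdivide N (half x) D<h h≤ E₁.gaps′)
      join : ∀ {y z} → y ≡ half x + z → half x + y ≡ x + z
      join {z = z} refl = trans (sym (+-assoc (half x) (half x) z)) (cong (_+ z) (half+half x))

    -- A step of length 0 inserts no gap, which gives `stay`; this later keeps two consecutive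
    -- points of the baton in one row.
    record Track {k} (L : Fin k → ℝ) : Set where
      field
        {size} : ℕ
        hs     : Vec ℝ size
        gaps   : Gaps hs
        mark   : Fin (suc k) → Fin (suc size)
        mark₀  : mark zero ≡ zero
        stay   : ∀ j → L j ≡ 0ℝ → mark (inject₁ j) ≡ mark (suc j)
        at     : ∀ j → pos hs (mark j) ≡ partialSum R k L j
        total≡ : total (lookup hs) ≡ total L

    track : ∀ N {k} (L : Fin k → ℝ) → (∀ j → L j ≡ 0ℝ ⊎ (D < L j × L j ≤ dbl N g)) → Track L
    track N {zero} L _ = record
      { hs = [] ; gaps = [] ; mark = λ _ → zero ; mark₀ = refl ; stay = λ () ; at = λ { zero → refl } ; total≡ = refl }
    track N {suc k} L sizes with track N (L ∘ suc) (sizes ∘ suc) | sizes zero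
    ... | T | inj₁ L₀≡0 = record
      { hs     = T.hs
      ; gaps   = T.gaps
      ; mark   = λ { zero → zero ; (suc j) → T.mark j }
      ; mark₀  = refl
      ; stay   = λ { zero _ → sym T.mark₀ ; (suc j) → T.stay j }
      ; at     = λ { zero → refl ; (suc j) → trans (T.at j) (drop (partialSum R k (L ∘ suc) j)) }
      ; total≡ = trans T.total≡ (drop (total (L ∘ suc)))
      }
      where
      module T = Track T
      drop : ∀ x → x ≡ L zero + x
      drop x = sym (trans (cong (_+ x) L₀≡0) (+-identityˡ x))
    ... | T | inj₂ (D<L₀ , L₀≤) = record
      { hs     = E.hs′
      ; gaps   = E.gaps′
      ; mark   = λ { zero → zero ; (suc j) → E.emb (T.mark j) }
      ; mark₀  = refl
      ; stay   = λ { zero L₀≡0 → contradiction (subst (D <_) L₀≡0 D<L₀) (≤⇒≯ 0≤D)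
                   ; (suc j) L≡0 → cong E.emb (T.stay j L≡0) }
      ; at     = λ { zero → refl ; (suc j) → trans (E.pos-emb (T.mark j)) (cong (L zero +_) (T.at j)) }
      ; total≡ = trans E.total′ (cong (L zero +_) T.total≡)
      }
      where
      module T = Track T
      module E = Extension (subdivide N (L zero) D<L₀ L₀≤ T.gaps)

  -- β j = 0 is allowed: it stands for a step belonging to another level.
  record Frame {k} (β : Fin k → ℝ) : Set where
    field
      {size}    : ℕ
      a         : Fin (suc size) → ℝ
      a-nonneg  : ∀ x → 0ℝ ≤ a x
      a≤total   : ∀ x → a x ≤ total β
      injective : Injective _≡_ _≡_ a
      mark      : Fin (suc k) → Fin (suc size)
      at        : ∀ j → a (mark j) ≡ partialSum R k β j
      rich      : Rich size mark (λ j x y → Close (a x) (a y) (β j))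

  frame-zero : ∀ {k} {β : Fin k → ℝ} → (∀ j → β j ≡ 0ℝ) → Frame β
  frame-zero {β = β} β≡0 = record
    { a         = λ _ → 0ℝ
    ; a-nonneg  = λ _ → ≤-refl
    ; a≤total   = λ _ → total-nonneg 0≤β
    ; injective = λ _ → Fin1-unique
    ; mark      = λ _ → zero
    ; at        = λ j → sym (partialSum-zero β≡0 j)
    ; rich      = rich-point (λ j → close-refl 0ℝ (0≤β j))
    }
    where
    Fin1-unique : {x y : Fin 1} → x ≡ y
    Fin1-unique {zero} {zero} = refl
    0≤β : ∀ j → 0ℝ ≤ β j
    0≤β j = ≤-reflexive (sym (β≡0 j))

  -- Puts a translate of the lower frame U at every node of a path T for `L`. Where L j = 0 the path
  -- does not move and the lower frame handles the step. Where L j is at least 2g, the step covers g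
  -- + D, that is, one gap of T plus the diameter of U.
  frame-extend : ∀ {k} {α L β : Fin k → ℝ} {g} N → (∀ j → 0ℝ ≤ α j) → total α + total α < g →
    (∀ j → L j ≡ 0ℝ ⊎ (g + g ≤ L j × L j ≤ dbl N g)) → (∀ j → β j ≡ α j + L j) → Frame α → Frame β
  frame-extend {k} {α} {L} {β} {g} N 0≤α D+D<g sizes β≡α+L F = record
    { a         = a′
    ; a-nonneg  = λ x → +-nonneg (pos-nonneg T.gaps (quot x)) (F.a-nonneg (rem x))
    ; a≤total   = λ x → ≤-trans (+-mono-≤ (pos-≤-total T.gaps (quot x)) (F.a≤total (rem x))) (≤-reflexive total-β)
    ; injective = injective
    ; mark      = λ j → combine (T.mark j) (F.mark j)
    ; at        = λ j → trans (a′-combine (T.mark j) (F.mark j)) (trans (cong₂ _+_ (T.at j) (F.at j))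
                    (trans (+-comm _ _) (sym (partialSum-+ β≡α+L j))))
    ; rich      = rich-product T.size F.size {T.mark} {F.mark} steps F.rich
    }
    where
    module F = Frame F
    D = total α
    0≤D : 0ℝ ≤ D
    0≤D = total-nonneg 0≤α
    open Path 0≤D D+D<g
    sizes′ : ∀ j → L j ≡ 0ℝ ⊎ (D < L j × L j ≤ dbl N g)
    sizes′ j with sizes j
    ... | inj₁ L≡0 = inj₁ L≡0
    ... | inj₂ (2g≤L , L≤) = inj₂ (<-≤-trans D<2g 2g≤L , L≤)
      where
      D<2g : D < g + g
      D<2g = <-≤-trans (≤-<-trans (x≤x+y D 0≤D) D+D<g) (x≤x+y g 0≤g)
    module T = Track (track N L sizes′)
    q = suc F.size
    r = suc T.size

    quot : Fin (r *ℕ q) → Fin r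
    quot x = proj₁ (remQuot {r} q x)
    rem : Fin (r *ℕ q) → Fin q
    rem x = proj₂ (remQuot {r} q x)

    a′ : Fin (r *ℕ q) → ℝ
    a′ x = pos T.hs (quot x) + F.a (rem x)

    a′-combine : ∀ t u → a′ (combine t u) ≡ pos T.hs t + F.a u
    a′-combine t u = cong (λ p → pos T.hs (proj₁ p) + F.a (proj₂ p)) (Fin.remQuot-combine {r} {q} t u)

    total-β : total (lookup T.hs) + total α ≡ total β
    total-β = trans (cong (_+ total α) T.total≡) (trans (+-comm _ _) (sym (total-+ β≡α+L)))

    -- Offsets inside the lower frame are at most `D`, less than the separation of two nodes, so
    -- `a′` orders the pairs lexicographically.
    apart : ∀ {t t′} u u′ → t Fin.< t′ → pos T.hs t + F.a u < pos T.hs t′ + F.a u′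
    apart {t} {t′} u u′ t<t′ =
      <-≤-trans (≤-<-trans (+-monoʳ-≤ (pos T.hs t) (F.a≤total u)) (pos-separated T.gaps t<t′))
                (x≤x+y (pos T.hs t′) (F.a-nonneg u′))

    injective₂ : ∀ t t′ u u′ → pos T.hs t + F.a u ≡ pos T.hs t′ + F.a u′ → t ≡ t′ × u ≡ u′
    injective₂ t t′ u u′ eq with Fin.<-cmp t t′
    ... | tri< t<t′ _ _ = contradiction eq (<⇒≢ (apart u u′ t<t′))
    ... | tri≈ _ refl _ = refl , F.injective (+-cancelˡ (pos T.hs t) _ _ eq)
    ... | tri> _ _ t>t′ = contradiction (sym eq) (<⇒≢ (apart u′ u t>t′))

    injective : Injective _≡_ _≡_ a′
    injective {x} {y} eq =
      let t≡ , u≡ = injective₂ (quot x) (quot y) (rem x) (rem y) eq in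
      trans (sym (Fin.combine-remQuot {r} q x)) (trans (cong₂ combine t≡ u≡) (Fin.combine-remQuot {r} q y))

    Step : Fin k → Fin (r *ℕ q) → Fin (r *ℕ q) → Set
    Step j x y = Close (a′ x) (a′ y) (β j)

    steps : ∀ j → (T.mark (inject₁ j) ≡ T.mark (suc j) ×
                    (∀ (t : Fin r) {u u′} → Close (F.a u) (F.a u′) (α j) → Step j (combine t u) (combine t u′)))
                ⊎ (∀ {t t′ : Fin r} u u′ → Near t t′ → Step j (combine t u) (combine t′ u′))
    steps j with sizes j
    ... | inj₁ L≡0 = inj₁ (T.stay j L≡0 , within)
      where
      within : ∀ (t : Fin r) {u u′} → Close (F.a u) (F.a u′) (α j) → Step j (combine t u) (combine t u′)
      within t {u} {u′} cl rewrite a′-combine t u | a′-combine t u′ | β≡α+L j | L≡0 | +-comm (α j) 0ℝ =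
        close-+ (close-refl (pos T.hs t) ≤-refl) cl
    ... | inj₂ (2g≤L , _) = inj₂ across
      where
      g+D≤β : g + D ≤ β j
      g+D≤β = ≤-trans (+-monoʳ-≤ g D≤g) (≤-trans 2g≤L (≤-trans (y≤x+y (L j) (0≤α j)) (≤-reflexive (sym (β≡α+L j)))))
      across : ∀ {t t′ : Fin r} u u′ → Near t t′ → Step j (combine t u) (combine t′ u′)
      across {t} {t′} u u′ near rewrite a′-combine t u | a′-combine t′ u′ =
        close-mono g+D≤β (close-+ (pos-near T.gaps near)
          (close-interval (F.a-nonneg u) (F.a≤total u) (F.a-nonneg u′) (F.a≤total u′)))

  -- Grouping the steps into levels.

  module _ {k : ℕ} where

    -- Steps keep their indices while they are divided among levels; a step that is taken away
    -- becomes 0.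
    only except : Fin k → (Fin k → ℝ) → Fin k → ℝ
    only j α i with i Fin.≟ j
    ... | yes _ = α i
    ... | no  _ = 0ℝ
    except j α i with i Fin.≟ j
    ... | yes _ = 0ℝ
    ... | no  _ = α i

    except+only : ∀ j α i → α i ≡ except j α i + only j α i
    except+only j α i with i Fin.≟ j
    ... | yes _ = sym (+-identityˡ (α i))
    ... | no  _ = sym (+-identityʳ (α i))

    only-cases : ∀ j α i → only j α i ≡ 0ℝ ⊎ only j α i ≡ α j
    only-cases j α i with i Fin.≟ j
    ... | yes refl = inj₂ refl
    ... | no  _    = inj₁ refl

    except-cases : ∀ j α i → except j α i ≡ 0ℝ ⊎ except j α i ≡ α i
    except-cases j α i with i Fin.≟ j
    ... | yes _ = inj₁ refl
    ... | no  _ = inj₂ refl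

    -- `js` lists the indices whose steps may still be non-zero. Its length drops with each step
    -- removed and is the measure for the recursion.
    Supported : ∀ {n} → Vec (Fin k) n → (Fin k → ℝ) → Set
    Supported js α = ∀ i → α i ≡ 0ℝ ⊎ i ∈ᵛ js

    record Maximum {n} (js : Vec (Fin k) (suc n)) (α : Fin k → ℝ) : Set where
      field
        j    : Fin k
        rest : Vec (Fin k) n
        dec  : ∀ {i} → i ∈ᵛ js → i ≡ j ⊎ i ∈ᵛ rest
        max  : ∀ {i} → i ∈ᵛ js → α i ≤ α j

    maximum : ∀ {n} (js : Vec (Fin k) (suc n)) α → Maximum js α
    maximum (x ∷ []) α = record { j = x ; rest = [] ; dec = λ { (here p) → inj₁ p } ; max = λ { (here refl) → ≤-refl } }
    maximum (x ∷ js@(_ ∷ _)) α with maximum js α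
    ... | M with α (Maximum.j M) <?≤ α x
    ...   | inj₁ j<x = record
      { j = x ; rest = M.j ∷ M.rest
      ; dec = λ { (here p) → inj₁ p ; (there i∈) → inj₂ ([ here , there ]′ (M.dec i∈)) }
      ; max = λ { (here refl) → ≤-refl ; (there i∈) → ≤-trans (M.max i∈) (inj₁ j<x) }
      }
      where module M = Maximum M
    ...   | inj₂ x≤j = record
      { j = M.j ; rest = x ∷ M.rest
      ; dec = λ { (here p) → inj₂ (here p) ; (there i∈) → [ inj₁ , inj₂ ∘ there ]′ (M.dec i∈) }
      ; max = λ { (here refl) → x≤j ; (there i∈) → M.max i∈ }
      }
      where module M = Maximum M

    -- Takes out the largest step ρ. With g = ρ / 2 it is exactly 2g, the least size that
    -- `frame-extend` accepts, and all remaining steps are at most 2g.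
    module Split {n} (js : Vec (Fin k) (suc n)) (α : Fin k → ℝ) (0≤α : ∀ i → 0ℝ ≤ α i) (supp : Supported js α) where
      open Maximum (maximum js α) public

      ρ g : ℝ
      ρ = α j
      g = half ρ

      α≤ρ : ∀ i → α i ≤ ρ
      α≤ρ i with supp i
      ... | inj₁ α≡0 = ≤-trans (≤-reflexive α≡0) (0≤α j)
      ... | inj₂ i∈  = max i∈

      α′ : Fin k → ℝ
      α′ = except j α

      0≤α′ : ∀ i → 0ℝ ≤ α′ i
      0≤α′ i with except-cases j α i
      ... | inj₁ eq = ≤-reflexive (sym eq)
      ... | inj₂ eq = ≤-trans (0≤α i) (≤-reflexive (sym eq))

      α′≤2g : ∀ i → α′ i ≤ g + g
      α′≤2g i with except-cases j α i
      ... | inj₁ eq = ≤-trans (≤-reflexive eq) (≤-trans (0≤α j) (≤-reflexive (sym (half+half ρ))))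
      ... | inj₂ eq = ≤-trans (≤-reflexive eq) (≤-trans (α≤ρ i) (≤-reflexive (sym (half+half ρ))))

      supp′ : Supported rest α′
      supp′ i with i Fin.≟ j
      ... | yes _ = inj₁ refl
      ... | no i≢j with supp i
      ...   | inj₁ α≡0 = inj₁ α≡0
      ...   | inj₂ i∈  = [ (λ i≡j → contradiction i≡j i≢j) , inj₂ ]′ (dec i∈)

    -- α holds the steps not yet assigned to a level and L those of the level under construction.  Once
    -- total α is small compared with g the level is closed; otherwise max α ≥ g / 2ᵏ⁺¹ joins it, which
    -- keeps the ratios L i / g below a power of two known in advance.
    frame : ∀ n (js : Vec (Fin k) n) α → (∀ i → 0ℝ ≤ α i) → Supported js α → Frame α
    grow  : ∀ n (js : Vec (Fin k) n) α → (∀ i → 0ℝ ≤ α i) → Supported js α →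
            ∀ N (L : Fin k → ℝ) g {β : Fin k → ℝ} → 0ℝ < g → (∀ i → α i ≤ g + g) →
            (∀ i → L i ≡ 0ℝ ⊎ (g + g ≤ L i × L i ≤ dbl N g)) → (∀ i → β i ≡ α i + L i) → Frame β

    frame zero    [] α 0≤α supp = frame-zero (λ i → [ (λ eq → eq) , (λ ()) ]′ (supp i))
    frame (suc n) js α 0≤α supp with 0≤α j
      where open Split js α 0≤α supp
    -- A level starts with the largest step alone; it equals 2g, so the exponent `N` starts at 1.
    ... | inj₁ 0<ρ = grow n rest α′ 0≤α′ supp′ 1 (only j α) g (half-pos 0<ρ) α′≤2g sizes (except+only j α)
      where
      open Split js α 0≤α supp
      sizes : ∀ i → only j α i ≡ 0ℝ ⊎ (g + g ≤ only j α i × only j α i ≤ g + g)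
      sizes i with only-cases j α i
      ... | inj₁ eq = inj₁ eq
      ... | inj₂ eq = inj₂ (≤-reflexive (trans (half+half ρ) (sym eq)) , ≤-reflexive (trans eq (sym (half+half ρ))))
    ... | inj₂ 0≡ρ = frame-zero (λ i → ≤0⇒≡0 (0≤α i) (subst (α i ≤_) (sym 0≡ρ) (α≤ρ i)))
      where
      open Split js α 0≤α supp
      ≤0⇒≡0 : ∀ {x} → 0ℝ ≤ x → x ≤ 0ℝ → x ≡ 0ℝ
      ≤0⇒≡0 0≤x (inj₂ x≡0) = x≡0
      ≤0⇒≡0 0≤x (inj₁ x<0) = contradiction x<0 (≤⇒≯ 0≤x)

    grow n js α 0≤α supp N L g 0<g α≤2g sizes β≡ with (total α + total α) <?≤ g
    grow n js α 0≤α supp N L g 0<g α≤2g sizes β≡ | inj₁ small = frame-extend N 0≤α small sizes β≡ (frame n js α 0≤α supp)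
    grow zero [] α 0≤α supp N L g 0<g α≤2g sizes β≡ | inj₂ g≤ =
      contradiction (<-≤-trans 0<g g≤) (≤⇒≯ (total+total≤0 (λ i → [ ≤-reflexive , (λ ()) ]′ (supp i))))
    grow (suc n) js α 0≤α supp N L g {β} 0<g α≤2g sizes β≡ | inj₂ g≤ =
      grow n S.rest S.α′ S.0≤α′ S.supp′ (suc (suc k) +ℕ suc N) L′ S.g (half-pos 0<ρ) S.α′≤2g sizes′ β≡′
      where
      module S = Split js α 0≤α supp
      open S using (j; ρ)
      -- From g ≤ 2 `total α` and `total α` ≤ 2^k ρ follows g ≤ 2^(k+1) ρ, and ρ is twice the new
      -- gap bound `S.g`; hence the exponent k + 2.
      G = dbl (suc (suc k)) S.g
      g≤G : g ≤ G
      g≤G = ≤-trans g≤ (≤-trans (+-mono-≤ D≤ D≤) (≤-reflexive (trans (sym (dbl-+ k ρ ρ)) (cong (dbl (suc k)) (sym (half+half ρ))))))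
        where
        D≤ : total α ≤ dbl k ρ
        D≤ = total≤dbl (0≤α j) S.α≤ρ
      0<ρ : 0ℝ < ρ
      0<ρ with 0≤α j
      ... | inj₁ 0<ρ = 0<ρ
      ... | inj₂ 0≡ρ = contradiction (<-≤-trans 0<g g≤) (≤⇒≯ (total+total≤0 (λ i → subst (α i ≤_) (sym 0≡ρ) (S.α≤ρ i))))
      0≤G : 0ℝ ≤ G
      0≤G = ≤-trans (inj₁ 0<g) g≤G
      ρ≤G : ρ ≤ G
      ρ≤G = subst (_≤ G) (half+half ρ) (x≤dbl (suc k) (+-nonneg (inj₁ (half-pos 0<ρ)) (inj₁ (half-pos 0<ρ))))
      L′ : Fin k → ℝ
      L′ i = L i + only j α i
      β≡′ : ∀ i → β i ≡ S.α′ i + L′ i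
      β≡′ i = trans (β≡ i) (trans (cong (_+ L i) (except+only j α i))
        (solve 3 (λ x y z → (x ⊕ y) ⊕ z ⊜ x ⊕ (z ⊕ y)) refl (S.α′ i) (only j α i) (L i)))
      only-nonneg : ∀ i → 0ℝ ≤ only j α i
      only-nonneg i with only-cases j α i
      ... | inj₁ eq = ≤-reflexive (sym eq)
      ... | inj₂ eq = ≤-trans (0≤α j) (≤-reflexive (sym eq))
      only≤ : ∀ i → only j α i ≤ dbl N G
      only≤ i with only-cases j α i
      ... | inj₁ eq = ≤-trans (≤-reflexive eq) (≤-trans 0≤G (x≤dbl N 0≤G))
      ... | inj₂ eq = ≤-trans (≤-reflexive eq) (≤-trans ρ≤G (x≤dbl N 0≤G))
      L≤ : ∀ i → L i ≤ dbl N G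
      L≤ i with sizes i
      ... | inj₁ eq       = ≤-trans (≤-reflexive eq) (≤-trans 0≤G (x≤dbl N 0≤G))
      ... | inj₂ (_ , le) = ≤-trans le (dbl-mono N g≤G)
      -- The bounds 2^N G for `L` and for the new step are added, at the cost of one more doubling.
      L′≤ : ∀ i → L′ i ≤ dbl (suc (suc k) +ℕ suc N) S.g
      L′≤ i = ≤-trans (+-mono-≤ (L≤ i) (only≤ i))
        (≤-reflexive (trans (sym (dbl-+ N G G)) (dbl-dbl (suc N) (suc (suc k)) S.g)))
      sizes′ : ∀ i → L′ i ≡ 0ℝ ⊎ (S.g + S.g ≤ L′ i × L′ i ≤ dbl (suc (suc k) +ℕ suc N) S.g)
      sizes′ i with sizes i | only-cases j α i
      ... | inj₁ L≡0 | inj₁ o≡0 = inj₁ (trans (cong₂ _+_ L≡0 o≡0) (+-identityʳ 0ℝ))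
      ... | inj₁ L≡0 | inj₂ o≡ρ = inj₂ (≤-reflexive (trans (half+half ρ) (sym (trans (cong₂ _+_ L≡0 o≡ρ) (+-identityˡ ρ)))) , L′≤ i)
      -- Earlier members of the level stay large enough: they are at least 2g, which dominates every
      -- remaining step, in particular ρ.
      ... | inj₂ (2g≤L , _) | _ = inj₂ (≤-trans (≤-reflexive (half+half ρ))
                                    (≤-trans (α≤2g j) (≤-trans 2g≤L (x≤x+y (L i) (only-nonneg i)))) , L′≤ i)

  -- From consecutive steps to an isometric copy.

  walk : ∀ {k} {α : Fin k → ℝ} (x : Fin (suc k) → ℝ) → (∀ j → Close (x (inject₁ j)) (x (suc j)) (α j)) →
    ∀ i j → i Fin.≤ j → ∃ λ c → partialSum R k α j ≡ c + partialSum R k α i × Close (x i) (x j) c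
  walk {zero} x step zero zero _ = 0ℝ , sym (+-identityʳ 0ℝ) , close-refl (x zero) ≤-refl
  walk {suc k} x step zero zero _ = 0ℝ , sym (+-identityʳ 0ℝ) , close-refl (x zero) ≤-refl
  walk {suc k} {α} x step zero (suc j) _ =
    let c , eq , close = walk (x ∘ suc) (step ∘ suc) zero j Data.Nat.z≤n in
    α zero + c , trans (cong (α zero +_) eq) (sym (+-assoc (α zero) c 0ℝ)) , close-trans (step zero) close
  walk {suc k} {α} x step (suc i) (suc j) (s≤s i≤j) =
    let c , eq , close = walk (x ∘ suc) (step ∘ suc) i j i≤j in
    c , trans (cong (α zero +_) eq)
          (solve 3 (λ a c p → a ⊕ (c ⊕ p) ⊜ c ⊕ (a ⊕ p)) refl (α zero) c (partialSum R k (α ∘ suc) i)) , close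

  partialSum-suc : ∀ {k} (α : Fin k → ℝ) j → partialSum R k α (suc j) ≡ partialSum R k α (inject₁ j) + α j
  partialSum-suc {suc k} α zero    = trans (+-identityʳ (α zero)) (sym (+-identityˡ (α zero)))
  partialSum-suc {suc k} α (suc j) =
    trans (cong (α zero +_) (partialSum-suc (α ∘ suc) j)) (sym (+-assoc (α zero) _ (α (suc j))))

  -- By the triangle inequality the steps bound each coordinate gap by the distance in the baton,
  -- and direction `i`, where positions are exact, attains it.
  walk⇒copy : ∀ {k n} {α : Fin k → ℝ} → (∀ j → 0ℝ ≤ α j) → (f : Fin (suc k) → Fin n → ℝ) (i : Fin n) →
    (∀ j → f j i ≡ partialSum R k α j) → (∀ j l → l ≢ i → Close (f (inject₁ j) l) (f (suc j) l) (α j)) →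
    IsBatonCopy R k α n f
  walk⇒copy {k} {n} {α} 0≤α f i at step u v u≤v =
      (λ l → let c , eq , close = walk (λ j → f j l) (λ j → step′ j l) u v u≤v in
        close⇒AbsLe (subst (Close (f u l) (f v l)) (sym (trans (cong (_- P u) (trans eq (+-comm c (P u)))) (y+c-y (P u) c))) close))
    -- For u ≤ v the difference in direction `i` is minus the distance, whence the second
    -- alternative of `AbsEq`.
    , inj₂ (i , inj₂ (trans (cong (λ x → - x) (cong₂ _-_ (at u) (at v))) (neg-minus (P u) (P v))))
    where
    P = partialSum R k α
    neg-minus : ∀ x y → - (x - y) ≡ y - x
    neg-minus x y = trans (sym (-‿+-comm x (- y))) (trans (cong ((- x) +_) (-‿involutive y)) (+-comm (- x) y))
    step′ : ∀ j l → Close (f (inject₁ j) l) (f (suc j) l) (α j)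
    step′ j l with l Fin.≟ i
    ... | no l≢i = step j l l≢i
    ... | yes refl = subst₂ (λ x y → Close x y (α j)) (sym (at (inject₁ j))) (sym (trans (at (suc j)) (partialSum-suc α j)))
      (≤-trans (x≤x+y _ (0≤α j)) (x≤x+y _ (0≤α j)) , ≤-refl)

theorem4 : (R : RealField) → let open RealField R in
    (k : ℕ) → (α : Fin (suc k) → ℝ) → (∀ i → 0ℝ < α i) →
    Σ ℕ λ m → Σ (Fin (suc m) → ℝ) λ a → Injective _≡_ _≡_ a ×
    ((n : ℕ) → 0 <ℕ n → (B : List (Vec (Fin (suc m)) n)) → Unique B → m ^ n <ℕ length B →
    Σ (Fin (suc (suc k)) → Vec (Fin (suc m)) n) λ f →
    (∀ j → f j ∈ B) × IsBatonCopy R (suc k) α n (λ j → point R a (f j)))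
theorem4 R k α 0<α = size , a , injective , λ n _ B unique m^n<∣B∣ →
  let i , b = rich⇒baton rich n B unique m^n<∣B∣
      module b = Baton b
  in b.pt , (λ j → indicator⇒∈ B (b.pt j) (b.mem j)) ,
     walk⇒copy 0≤α (λ j → point R a (b.pt j)) i (λ j → trans (cong a (b.at j)) (at j)) b.step
  where
  open Combinatorics
  open OrderedField R
  0≤α : ∀ i → RealField._≤_ R (RealField.0ℝ R) (α i)
  0≤α i = inj₁ (0<α i)
  -- Every index is listed at the start. The frame has `size` + 1 points and is rich with parameter
  -- `size`, which is therefore the m of the claim.
  open Frame (frame (suc k) (allFin (suc k)) α 0≤α (λ i → inj₂ (∈-allFin⁺ i)))
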